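{- As $n\to\infty$, $$\mathrm{ex}(Q_n, C_{10}) = \Omega\left(\frac{n}{\log^a n}\,2^n\right), \quad\text{where } a=\log_2 3.$$
   Context: The hypercube $Q_n$ is the graph with vertex set $\{A : A\subseteq [n]\}$ and edge set all pairs $\{A,B\}$ with $A\subseteq B$ and $|A|=|B|-1$. $C_{10}$ is the cycle of length $10$. For a graph $H$, $\mathrm{ex}(Q_n,H)$ is the largest number of edges in a subgraph $G$ of $Q_n$ such that no subgraph of $G$ is isomorphic to $H$. $\log^a n$ means $(\log n)^a$. -}

module Defs where

open import Data.Bool.Base using (Bool; true; false; T; _∧_)
open import Data.Bool.Properties using (T?; T-∧; T-irrelevant; ∧-comm)
open import Data.Empty using (⊥-elim)
open import Data.Fin.Base using (Fin; zero; toℕ; finToFun; funToFin)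
open import Data.Fin.Properties
  using (any?; all?; *↔×; 2↔Bool; finToFun-funToFin; inj⇒≟)
open import Data.Fin.Subset using (Subset; _⊆_; ∣_∣)
open import Data.Fin.Subset.Properties using (_⊆?_)
open import Data.Integer.Base as ℤ using (+_)
open import Data.List.Base using (List; []; _∷_; _++_; map; filter; length; allFin; cartesianProductWith)
open import Data.List.Extrema.Nat using (max; xs≤max; argmax-sel)
open import Data.List.Membership.Propositional using (_∈_)
open import Data.List.Membership.Propositional.Properties
  using (∈-map⁺; ∈-map⁻; ∈-filter⁺; ∈-filter⁻; ∈-allFin; ∈-cartesianProductWith⁺)
open import Data.List.Properties using (filter-≐; filter-none)
open import Data.List.Relation.Unary.All as All using ()
open import Data.Nat.Base using (ℕ; zero; suc; _*_; _^_; _≤_; _<_; s≤s)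
open import Data.Nat.Properties using (_≟_; _≤?_; 1+n≢n)
open import Data.Product.Base using (Σ; ∃; ∃₂; _×_; _,_; proj₁; proj₂; uncurry)
open import Data.Product.Function.NonDependent.Propositional using (_×-↔_)
open import Data.Rational.Base as ℚ using (ℚ; 0ℚ; ↥_; ↧ₙ_)
open import Data.Sum.Base using (_⊎_; inj₁; inj₂; [_,_]; swap)
open import Data.Vec.Base using ([]; _∷_)
open import Algebra.Definitions.RawSemiring ℚ.+-*-rawSemiring
  using () renaming (_^_ to _^ℚ_)
open import Function.Base using (_∘_)
open import Function.Bundles using (_↔_; _⇔_; mk⇔; mk↔ₛ′; Inverse; Equivalence)
open import Function.Construct.Composition using (_↔-∘_)
open import Function.Construct.Symmetry using (↔-sym)
open import Function.Properties.Inverse using (↔⇒↣)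
open import Relation.Binary.Definitions using (Decidable; DecidableEquality; Irreflexive; Symmetric)
open import Relation.Binary.PropositionalEquality
  using (_≡_; refl; trans; cong; subst; subst₂; _≗_)
  renaming (sym to ≡-sym)
open import Relation.Nullary.Decidable
  using (Dec; yes; no; True; toWitness; does; map′; ¬?; _×-dec_; _⊎-dec_; _→-dec_)
open import Relation.Nullary.Negation using (¬_)

------------------------------------------------------------------------

record Graph : Set₁ where
  field
    Vertex : Set
    Adj    : Vertex → Vertex → Set
    adj?   : Decidable Adj
    sym    : Symmetric Adj
    irrefl : Irreflexive _≡_ Adj

record FiniteGraph : Set₁ where
  field
    graph : Graph
    order : ℕ
    enum  : Graph.Vertex graph ↔ Fin order
  open Graph graph public

  vertices : List Vertex
  vertices = map (Inverse.from enum) (allFin order)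

open FiniteGraph using (graph; vertices)

record Subgraph (G : Graph) : Set where
  private module G = Graph G
  field
    vertex : G.Vertex → Bool
    adj    : G.Vertex → G.Vertex → Bool
    sym    : ∀ {u v} → T (adj u v) → T (adj v u)
    ends   : ∀ {u v} → T (adj u v) → T (vertex u)
    incl   : ∀ {u v} → T (adj u v) → G.Adj u v

  toGraph : Graph
  toGraph = record
    { Vertex = Σ G.Vertex (T ∘ vertex)
    ; Adj    = λ u v → T (adj (proj₁ u) (proj₁ v))
    ; adj?   = λ _ _ → T? _
    ; sym    = sym
    ; irrefl = λ { refl → G.irrefl refl ∘ incl }
    }

open Subgraph using (toGraph)

record _≅_ (G H : Graph) : Set where
  private
    module G = Graph G
    module H = Graph H
  field
    bijection : G.Vertex ↔ H.Vertex
  open Inverse bijection public using (to; from; strictlyInverseˡ; strictlyInverseʳ)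
  field
    preserves : ∀ u v → G.Adj u v ⇔ H.Adj (to u) (to v)

_Contains_ : Graph → Graph → Set
G Contains H = ∃ λ (S : Subgraph G) → toGraph S ≅ H

Free : (H : Graph) {G : Graph} → Subgraph G → Set
Free H F = ¬ (toGraph F Contains H)

------------------------------------------------------------------------

-- All (xᵢ , xⱼ) with i < j.
pairs : {A : Set} → List A → List (A × A)
pairs []       = []
pairs (x ∷ xs) = map (x ,_) xs ++ pairs xs

edges : (G : FiniteGraph) → Subgraph (graph G) → List (FiniteGraph.Vertex G × FiniteGraph.Vertex G)
edges G F = filter (T? ∘ uncurry (Subgraph.adj F)) (pairs (vertices G))

edgeCount : (G : FiniteGraph) → Subgraph (graph G) → ℕ
edgeCount G F = length (edges G F)

------------------------------------------------------------------------

private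
  T⇔does : {P : Set} (P? : Dec P) → T (does P?) ⇔ P
  T⇔does (yes p) = mk⇔ (λ _ → p) _
  T⇔does (no ¬p) = mk⇔ (λ ()) ¬p

  module Search (H G : FiniteGraph) (F : Subgraph (graph G)) where
    private
      module H = FiniteGraph H
      module G = FiniteGraph G
      module F = Subgraph F
      module Hₑ = Inverse H.enum
      module Gₑ = Inverse G.enum

    _≟H_ : DecidableEquality H.Vertex
    _≟H_ = inj⇒≟ (↔⇒↣ H.enum)

    _≟G_ : DecidableEquality G.Vertex
    _≟G_ = inj⇒≟ (↔⇒↣ G.enum)

    anyH? : {P : H.Vertex → Set} → (∀ h → Dec (P h)) → Dec (∃ P)
    anyH? {P} P? = map′ (λ (i , p) → Hₑ.from i , p)
                        (λ (h , p) → Hₑ.to h , subst P (≡-sym (Hₑ.strictlyInverseʳ h)) p)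
                        (any? (P? ∘ Hₑ.from))

    record Embedding (f : H.Vertex → G.Vertex) : Set where
      constructor embedding
      field
        injective : ∀ a b → f a ≡ f b → a ≡ b
        inside    : ∀ a → T (F.vertex (f a))
        hom       : ∀ a b → H.Adj a b → T (F.adj (f a) (f b))

    allH? : {P : H.Vertex → Set} → (∀ h → Dec (P h)) → Dec (∀ h → P h)
    allH? {P} P? = map′ (λ p h → subst P (Hₑ.strictlyInverseʳ h) (p (Hₑ.to h)))
                        (λ p i → p (Hₑ.from i))
                        (all? (P? ∘ Hₑ.from))

    embedding? : ∀ f → Dec (Embedding f)
    embedding? f = map′ (λ (i , s , h) → embedding i s h)
                        (λ (embedding i s h) → i , s , h)
      (allH? (λ a → allH? λ b → (f a ≟G f b) →-dec (a ≟H b))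
       ×-dec allH? (λ a → T? _)
       ×-dec allH? (λ a → allH? λ b → H.adj? a b →-dec T? _))

    embedding-resp : ∀ {f g} → f ≗ g → Embedding f → Embedding g
    embedding-resp {f} {g} eq E = embedding
      (λ a b p → injective a b (trans (eq a) (trans p (≡-sym (eq b)))))
      (λ a → subst (T ∘ F.vertex) (eq a) (inside a))
      (λ a b p → subst₂ (λ x y → T (F.adj x y)) (eq a) (eq b) (hom a b p))
      where
        open Embedding E

    decode : Fin (G.order ^ H.order) → H.Vertex → G.Vertex
    decode c h = Gₑ.from (finToFun c (Hₑ.to h))

    encode : (H.Vertex → G.Vertex) → Fin (G.order ^ H.order)
    encode f = funToFin (Gₑ.to ∘ f ∘ Hₑ.from)

    decode-encode : ∀ f → f ≗ decode (encode f)
    decode-encode f h = ≡-sym (trans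
      (cong Gₑ.from (finToFun-funToFin (Gₑ.to ∘ f ∘ Hₑ.from) (Hₑ.to h)))
      (trans (Gₑ.strictlyInverseʳ _) (cong f (Hₑ.strictlyInverseʳ h))))

    ∃embedding? : Dec (∃ Embedding)
    ∃embedding? = map′ (λ (c , E) → decode c , E)
                       (λ (f , E) → encode f , embedding-resp (decode-encode f) E)
                       (any? (embedding? ∘ decode))

    Σ-≡ : ∀ {u v : Σ G.Vertex (T ∘ F.vertex)} → proj₁ u ≡ proj₁ v → u ≡ v
    Σ-≡ {_ , p} {_ , q} refl = cong (_ ,_) (T-irrelevant p q)

    from-contains : toGraph F Contains graph H → ∃ Embedding
    from-contains (S , iso) = f , embedding inj (λ a → proj₂ (proj₁ (I.from a))) pres
      where
        module I = _≅_ iso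
        module S = Subgraph S
        f : H.Vertex → G.Vertex
        f a = proj₁ (proj₁ (I.from a))
        inj : ∀ a b → f a ≡ f b → a ≡ b
        inj a b eq = trans (≡-sym (I.strictlyInverseˡ a)) (trans (cong I.to lem) (I.strictlyInverseˡ b))
          where
            lem₂ : {x y : Graph.Vertex (toGraph S)} → proj₁ x ≡ proj₁ y → x ≡ y
            lem₂ {_ , p} {_ , q} refl = cong (_ ,_) (T-irrelevant p q)
            lem : I.from a ≡ I.from b
            lem = lem₂ (Σ-≡ eq)
        pres : ∀ a b → H.Adj a b → T (F.adj (f a) (f b))
        pres a b h = S.incl (Equivalence.from (I.preserves (I.from a) (I.from b))
          (subst₂ H.Adj (≡-sym (I.strictlyInverseˡ a)) (≡-sym (I.strictlyInverseˡ b)) h))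

    to-contains : ∃ Embedding → toGraph F Contains graph H
    to-contains (f , E) = S , record { bijection = bij ; preserves = pres }
      where
        open Embedding E
        V = Σ G.Vertex (T ∘ F.vertex)
        Im : V → Set
        Im v = ∃ λ a → f a ≡ proj₁ v
        im? : ∀ v → Dec (Im v)
        im? v = anyH? λ a → f a ≟G proj₁ v
        ImAdj : V → V → Set
        ImAdj u v = ∃ λ a → ∃ λ b → f a ≡ proj₁ u × f b ≡ proj₁ v × H.Adj a b
        imAdj? : ∀ u v → Dec (ImAdj u v)
        imAdj? u v = anyH? λ a → anyH? λ b → (f a ≟G proj₁ u) ×-dec (f b ≟G proj₁ v) ×-dec H.adj? a b
        ⟨_⟩ : ∀ {P} {P? : Dec P} → T (does P?) → P
        ⟨_⟩ {P? = P?} = Equivalence.to (T⇔does P?)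
        mk : ∀ {P} {P? : Dec P} → P → T (does P?)
        mk {P? = P?} = Equivalence.from (T⇔does P?)
        S : Subgraph (toGraph F)
        S = record
          { vertex = λ v → does (im? v)
          ; adj    = λ u v → does (imAdj? u v)
          ; sym    = λ {u} {v} t → let (a , b , p , q , h) = ⟨_⟩ {P? = imAdj? u v} t in
                       mk {P? = imAdj? v u} (b , a , q , p , H.sym h)
          ; ends   = λ {u} {v} t → let (a , b , p , q , h) = ⟨_⟩ {P? = imAdj? u v} t in
                       mk {P? = im? u} (a , p)
          ; incl   = λ {u} {v} t → let (a , b , p , q , h) = ⟨_⟩ {P? = imAdj? u v} t in
                       subst₂ (λ x y → T (F.adj x y)) p q (hom a b h)
          }
        to : Σ V (λ v → T (does (im? v))) → H.Vertex
        to (v , t) = proj₁ (⟨_⟩ {P? = im? v} t)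
        f-to : ∀ v → f (to v) ≡ proj₁ (proj₁ v)
        f-to (v , t) = proj₂ (⟨_⟩ {P? = im? v} t)
        from : H.Vertex → Σ V (λ v → T (does (im? v)))
        from a = (f a , inside a) , mk {P? = im? (f a , inside a)} (a , refl)
        lem₂ : {x y : Σ V (λ v → T (does (im? v)))} → proj₁ x ≡ proj₁ y → x ≡ y
        lem₂ {_ , p} {_ , q} refl = cong (_ ,_) (T-irrelevant p q)
        bij : Σ V (λ v → T (does (im? v))) ↔ H.Vertex
        bij = mk↔ₛ′ to from (λ a → injective _ _ (f-to (from a)))
                            (λ v → lem₂ (Σ-≡ (f-to v)))
        pres : ∀ u v → T (does (imAdj? (proj₁ u) (proj₁ v))) ⇔ H.Adj (to u) (to v)
        pres u v = mk⇔
          (λ t → let (a , b , p , q , h) = ⟨_⟩ {P? = imAdj? (proj₁ u) (proj₁ v)} t in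
            subst₂ H.Adj (injective _ _ (trans p (≡-sym (f-to u))))
                         (injective _ _ (trans q (≡-sym (f-to v)))) h)
          (λ h → mk {P? = imAdj? (proj₁ u) (proj₁ v)} (to u , to v , f-to u , f-to v , h))

    contains? : Dec (toGraph F Contains graph H)
    contains? = map′ to-contains from-contains ∃embedding?

free? : (H G : FiniteGraph) (F : Subgraph (graph G)) → Dec (Free (graph H) F)
free? H G F = ¬? (Search.contains? H G F)

------------------------------------------------------------------------

restrict : (G : Graph) → (Graph.Vertex G → Bool) → (Graph.Vertex G → Graph.Vertex G → Bool) → Subgraph G
restrict G w a = record
  { vertex = w
  ; adj    = λ u v → does (G.adj? u v) ∧ (w u ∧ w v) ∧ (a u v ∧ a v u)
  ; sym    = λ {u} {v} t →
      let (g , r) = Equivalence.to (T-∧ {does (G.adj? u v)}) t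
          (x , y) = Equivalence.to (T-∧ {w u ∧ w v}) r
      in Equivalence.from T-∧
           ( Equivalence.from (T⇔does (G.adj? v u)) (G.sym (Equivalence.to (T⇔does (G.adj? u v)) g))
           , Equivalence.from T-∧ ( subst T (∧-comm (w u) (w v)) x
                                  , subst T (∧-comm (a u v) (a v u)) y))
  ; ends   = λ {u} {v} t →
      let (g , r) = Equivalence.to (T-∧ {does (G.adj? u v)}) t
          (x , y) = Equivalence.to (T-∧ {w u ∧ w v}) r
      in proj₁ (Equivalence.to (T-∧ {w u}) x)
  ; incl   = λ {u} {v} t → Equivalence.to (T⇔does (G.adj? u v)) (proj₁ (Equivalence.to T-∧ t))
  }
  where module G = Graph G

module _ (G : FiniteGraph) where
  private
    module G = FiniteGraph G
    module Gₑ = Inverse G.enum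

    bit : Fin 2 → Bool
    bit = Inverse.to 2↔Bool

  vertexPredicate : Fin (2 ^ G.order) → G.Vertex → Bool
  vertexPredicate c v = bit (finToFun c (Gₑ.to v))

  edgePredicate : Fin ((2 ^ G.order) ^ G.order) → G.Vertex → G.Vertex → Bool
  edgePredicate c u = vertexPredicate (finToFun c (Gₑ.to u))

  subgraphs : List (Subgraph (graph G))
  subgraphs = cartesianProductWith (λ c d → restrict (graph G) (vertexPredicate c) (edgePredicate d))
                                   (allFin _) (allFin _)

------------------------------------------------------------------------

-- The value is 0 in the degenerate case (H without vertices) where no
-- subgraph is H-free; ex-upper and ex-attained below show that it is
-- otherwise the largest number of edges of an H-free subgraph.
ex : FiniteGraph → FiniteGraph → ℕ
ex G H = max 0 (map (edgeCount G) (filter (free? H G) (subgraphs G)))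

private
  record _≐_ {G : Graph} (F F′ : Subgraph G) : Set where
    constructor _,_
    field
      vertex-≐ : ∀ v → Subgraph.vertex F v ≡ Subgraph.vertex F′ v
      adj-≐    : ∀ u v → Subgraph.adj F u v ≡ Subgraph.adj F′ u v

  contains-resp : (H G : FiniteGraph) {F F′ : Subgraph (graph G)} → F ≐ F′ →
                  toGraph F Contains graph H → toGraph F′ Contains graph H
  contains-resp H G {F} {F′} (vs , as) c with Search.from-contains H G F c
  ... | f , E = Search.to-contains H G F′ (f , Search.embedding (E.injective)
      (λ a → subst T (vs _) (E.inside a))
      (λ a b h → subst T (as _ _) (E.hom a b h)))
    where module E = Search.Embedding E

  edgeCount-resp : (G : FiniteGraph) {F F′ : Subgraph (graph G)} → F ≐ F′ → edgeCount G F ≡ edgeCount G F′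
  edgeCount-resp G {F} {F′} (_ , as) = cong length (filter-≐ _ _
    ((λ {p} → subst T (as _ _)) , (λ {p} → subst T (≡-sym (as _ _)))) (pairs (vertices G)))

  module _ (G : FiniteGraph) (F : Subgraph (graph G)) where
    private
      module G  = FiniteGraph G
      module F  = Subgraph F
      module Gₑ = Inverse G.enum
      module B  = Inverse 2↔Bool

    vertexCode : (G.Vertex → Bool) → Fin (2 ^ G.order)
    vertexCode w = funToFin (B.from ∘ w ∘ Gₑ.from)

    vertexCode-correct : ∀ w v → vertexPredicate G (vertexCode w) v ≡ w v
    vertexCode-correct w v = trans
      (cong B.to (finToFun-funToFin (B.from ∘ w ∘ Gₑ.from) (Gₑ.to v)))
      (trans (B.strictlyInverseˡ _) (cong w (Gₑ.strictlyInverseʳ v)))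

    edgeCode : Fin ((2 ^ G.order) ^ G.order)
    edgeCode = funToFin (λ i → vertexCode (F.adj (Gₑ.from i)))

    edgeCode-correct : ∀ u v → edgePredicate G edgeCode u v ≡ F.adj u v
    edgeCode-correct u v = trans
      (cong (λ c → vertexPredicate G c v)
        (finToFun-funToFin (λ i → vertexCode (F.adj (Gₑ.from i))) (Gₑ.to u)))
      (trans (vertexCode-correct _ v) (cong (λ x → F.adj x v) (Gₑ.strictlyInverseʳ u)))

    T-ext : ∀ {a b} → (T a → T b) → (T b → T a) → a ≡ b
    T-ext {false} {false} _ _ = refl
    T-ext {false} {true}  _ g = ⊥-elim (g _)
    T-ext {true}  {false} f _ = ⊥-elim (f _)
    T-ext {true}  {true}  _ _ = refl

    restrict-≐ : ∀ {w a} → (∀ v → w v ≡ F.vertex v) → (∀ u v → a u v ≡ F.adj u v) →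
                 F ≐ restrict (graph G) w a
    restrict-≐ {w} {a} eqw eqa = (λ v → ≡-sym (eqw v)) , λ u v → T-ext
      (λ t → Equivalence.from T-∧
        ( Equivalence.from (T⇔does (G.adj? u v)) (F.incl t)
        , Equivalence.from T-∧
          ( Equivalence.from T-∧ ( subst T (≡-sym (eqw u)) (F.ends t)
                                 , subst T (≡-sym (eqw v)) (F.ends (F.sym t)))
          , Equivalence.from T-∧ ( subst T (≡-sym (eqa u v)) t
                                 , subst T (≡-sym (eqa v u)) (F.sym t)))))
      (λ t → subst T (eqa u v)
        (proj₁ (Equivalence.to T-∧ (proj₂ (Equivalence.to (T-∧ {w u ∧ w v})
          (proj₂ (Equivalence.to (T-∧ {does (G.adj? u v)}) t)))))))

    subgraphs-complete : ∃ λ F′ → F′ ∈ subgraphs G × F ≐ F′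
    subgraphs-complete = _
      , ∈-cartesianProductWith⁺ _ (∈-allFin (vertexCode F.vertex)) (∈-allFin edgeCode)
      , restrict-≐ (vertexCode-correct F.vertex) edgeCode-correct

  ≐-sym : ∀ {G} {F F′ : Subgraph G} → F ≐ F′ → F′ ≐ F
  ≐-sym (vs , as) = (λ v → ≡-sym (vs v)) , λ u v → ≡-sym (as u v)

ex-upper : (G H : FiniteGraph) (F : Subgraph (graph G)) → Free (graph H) F → edgeCount G F ≤ ex G H
ex-upper G H F free with subgraphs-complete G F
... | F′ , F′∈ , F≐F′ = subst (_≤ ex G H) (≡-sym (edgeCount-resp G F≐F′))
  (All.lookup (xs≤max 0 _)
    (∈-map⁺ (edgeCount G)
      (∈-filter⁺ (free? H G) F′∈ (free ∘ contains-resp H G (≐-sym F≐F′)))))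

ex-attained : (G H : FiniteGraph) → FiniteGraph.Vertex H →
              ∃ λ (F : Subgraph (graph G)) → Free (graph H) F × edgeCount G F ≡ ex G H
ex-attained G H h with argmax-sel (λ m → m) 0 (map (edgeCount G) (filter (free? H G) (subgraphs G)))
... | inj₁ ex≡0 = ∅ , ∅-free , trans (cong length (filter-none (T? ∘ uncurry (Subgraph.adj ∅)) (All.universal (λ _ ()) (pairs (vertices G))))) (≡-sym ex≡0)
  where
    ∅ : Subgraph (graph G)
    ∅ = record { vertex = λ _ → false ; adj = λ _ _ → false
               ; sym = λ () ; ends = λ () ; incl = λ () }
    ∅-free : Free (graph H) ∅
    ∅-free (S , iso) = proj₂ (proj₁ (_≅_.from iso h))
... | inj₂ ex∈ with ∈-map⁻ (edgeCount G) ex∈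
... | F , F∈ , eq = F , proj₂ (∈-filter⁻ (free? H G) {xs = subgraphs G} F∈) , ≡-sym eq

------------------------------------------------------------------------

infix 4 _⋖_

_⋖_ : ∀ {n} → Subset n → Subset n → Set
A ⋖ B = A ⊆ B × suc ∣ A ∣ ≡ ∣ B ∣

subset↔Fin : ∀ n → Subset n ↔ Fin (2 ^ n)
subset↔Fin zero    = mk↔ₛ′ (λ _ → zero) (λ _ → []) (λ { zero → refl }) (λ { [] → refl })
subset↔Fin (suc n) = ↔-sym *↔× ↔-∘ ((↔-sym 2↔Bool ×-↔ subset↔Fin n) ↔-∘ uncons↔)
  where
    uncons↔ : Subset (suc n) ↔ (Bool × Subset n)
    uncons↔ = mk↔ₛ′ (λ { (b ∷ A) → b , A }) (λ { (b , A) → b ∷ A }) (λ _ → refl) (λ { (_ ∷ _) → refl })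

Q : ℕ → FiniteGraph
Q n = record
  { graph = record
    { Vertex = Subset n
    ; Adj    = λ A B → A ⋖ B ⊎ B ⋖ A
    ; adj?   = λ A B → (A ⋖? B) ⊎-dec (B ⋖? A)
    ; sym    = swap
    ; irrefl = λ { refl → [ ⋖-irrefl , ⋖-irrefl ] }
    }
  ; order = 2 ^ n
  ; enum  = subset↔Fin n
  }
  where
    _⋖?_ : (A B : Subset n) → Dec (A ⋖ B)
    A ⋖? B = (A ⊆? B) ×-dec (suc ∣ A ∣ ≟ ∣ B ∣)
    ⋖-irrefl : ∀ {A : Subset n} → ¬ (A ⋖ A)
    ⋖-irrefl (_ , p) = 1+n≢n p

-- j is the cyclic successor of i.
Next : ∀ {k} → Fin k → Fin k → Set
Next {k} i j = suc (toℕ i) ≡ toℕ j ⊎ (suc (toℕ i) ≡ k × toℕ j ≡ 0)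

C : (k : ℕ) {3≤k : True (3 ≤? k)} → FiniteGraph
C k {3≤k} = record
  { graph = record
    { Vertex = Fin k
    ; Adj    = λ i j → Next i j ⊎ Next j i
    ; adj?   = λ i j → next? i j ⊎-dec next? j i
    ; sym    = swap
    ; irrefl = λ { refl → [ next-irrefl (toWitness 3≤k) , next-irrefl (toWitness 3≤k) ] }
    }
  ; order = k
  ; enum  = mk↔ₛ′ (λ i → i) (λ i → i) (λ _ → refl) (λ _ → refl)
  }
  where
    next? : (i j : Fin k) → Dec (Next i j)
    next? i j = (suc (toℕ i) ≟ toℕ j) ⊎-dec ((suc (toℕ i) ≟ k) ×-dec (toℕ j ≟ 0))
    next-irrefl : 3 ≤ k → {i : Fin k} → ¬ Next i i
    next-irrefl _ (inj₁ p) = 1+n≢n p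
    next-irrefl 3≤k {i} (inj₂ (p , q)) with toℕ i
    next-irrefl (s≤s ()) (inj₂ (refl , refl)) | _

------------------------------------------------------------------------

-- A real r as the set { q | r < q }.
UpperCut : Set₁
UpperCut = ℚ → Set

-- A real r as the set { q | q < r }.
LowerCut : Set₁
LowerCut = ℚ → Set

-- For n ≥ 1 and q = u / d ≥ 0:  log₂ n < q  iff  n ^ d < 2 ^ u.
log₂ : ℕ → UpperCut
log₂ n q = 0ℚ ℚ.≤ q × n ^ ↧ₙ q < 2 ^ ℤ.∣ ↥ q ∣

-- For r ≥ 1 and s ≥ 0, the real r ^ s is the infimum of all p ^ q with
-- p > r and q > s rational; for q = u / d and x ≥ 0, p ^ q < x means
-- p ^ u < x ^ d.  (For r < 1 this set is not the upper cut of r ^ s.)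
infixr 8 _^ᴿ_
_^ᴿ_ : UpperCut → UpperCut → UpperCut
(r ^ᴿ s) x = 0ℚ ℚ.≤ x × ∃₂ λ p q → (r p × 0ℚ ℚ.≤ p) × (s q × 0ℚ ℚ.≤ q)
                                  × p ^ℚ ℤ.∣ ↥ q ∣ ℚ.< x ^ℚ ↧ₙ q

fromℕ : ℕ → ℚ
fromℕ m = + m ℚ./ 1

-- For r > 0:  y < m / r  iff  y * x < m for some rational x > r.
infixl 7 _/ᴿ_
_/ᴿ_ : ℕ → UpperCut → LowerCut
(m /ᴿ r) y = ∃ λ x → r x × y ℚ.* x ℚ.< fromℕ m

-- f = Ω(g): for some rational c > 0, eventually c · g n ≤ f n.
_IsΩ_ : (ℕ → ℕ) → (ℕ → LowerCut) → Set
f IsΩ g = ∃ λ c → 0ℚ ℚ.< c × ∃ λ N → ∀ n → N ≤ n →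
          ∀ y → g n y → c ℚ.* y ℚ.≤ fromℕ (f n)

module Submission where

-- The edges of the hypercube are coloured with O(log n) colours so that no
-- colour class contains a cycle of length ten.  Each class then has at most
-- ex (Q n) (C 10) edges, and the classes together have n * 2 ^ n / 2, which
-- gives n * 2 ^ n = O(log n * ex (Q n) (C 10)) (ex-bound, ex-bound-log).  As
-- log₂ 3 ≥ 1, this is at least as strong as the theorem (log₂-power-bound).
--
-- Let h be a weight on ordered pairs of directions, with values in a vector
-- space over the field with two elements and with h x x = 0.  The edge at a set
-- u in direction x is coloured by the sum of h x y over the members y of u; as
-- h x x = 0, both ends of the edge give the same colour.  Three weights are used
-- together: differ (is y other than x), below (is y smaller than x) and the
-- binary code of the first position in which the binary expansions of x and y
-- differ, replaced by 0 for y = x.  The last takes about log n values; as a colouring of the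
-- pairs of directions it has no monochromatic triangle, since three bits
-- cannot be pairwise different (firstDiff-no-triangle).
--
-- Let d 0, ..., d 9 be the directions of the edges of a cycle of length ten in
-- one colour class.  Between two uses of a direction x the weights h x of the
-- directions used must sum to 0 (sum-return).  As every direction is used
-- an even number of times, h = differ shows that each is used exactly twice, at
-- places that are 3 or 5 apart round the cycle (≢₁, ≢₂, ≢₄, partner).
-- Thirteen ways to pair off the ten places remain.  If the directions read x y z x y somewhere, then x, y, z form a
-- monochromatic triangle (no-xyzxy).  The other pairings are excluded by
-- below.  If all distances are 5, then each of the five directions exceeds an
-- even number of the others, which makes the order on them dense
-- (no-five-recurrence).  If a distance of 3 occurs, then up to rotation and
-- reflection either all distances are 3, and the order alternates along a
-- cycle of length five (no-alternating-cycle), or exactly two are 3, and two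
-- directions of even rank are neighbours in the order (no-even-neighbours).

open import Defs
open import Data.Nat.Base using (ℕ; _*_; _^_)

open import Data.Bool.Base using (Bool; true; false; not; _∧_; _xor_; T; if_then_else_)
import Data.Bool.Properties as Bool
open import Data.Bool.Properties
  using (T?; T-irrelevant; not-involutive; not-distribʳ-xor; xor-comm; xor-assoc)
open import Data.Empty using (⊥; ⊥-elim)
open import Data.Fin.Base as Fin using (Fin; zero; suc; inject≤)
import Data.Fin.Induction as Fin
open import Data.Fin.Patterns using (0F; 1F; 2F; 3F; 4F; 5F; 6F; 7F; 8F; 9F)
import Data.Fin.Properties as Fin
open import Data.Fin.Subset using (Subset)
open import Data.Fin.Subset.Properties using (⊆-refl; out⊆; s⊆s)
open import Data.Integer.Base as ℤ using (+_)
import Data.Integer.Properties as ℤ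
open import Data.List.Base as List using (List; []; _∷_; _++_; map; filter; length; allFin)
open import Data.List.Membership.Propositional using (_∈_; lose)
open import Data.List.Membership.Propositional.Properties using (∈-map⁺; ∈-filter⁺; ∈-allFin)
open import Data.List.Properties
  using (filter-none; filter-++; length-++; length-map; length-tabulate)
open import Data.List.Relation.Unary.All as All using ()
open import Data.List.Relation.Unary.Any as Any using (Any; here; there; index)
open import Data.List.Relation.Unary.Any.Properties using (lookup-index)
open import Data.Nat.Base using (zero; suc; _+_; _≤_; _<_; z≤n; s≤s; s≤s⁻¹)
open import Data.Nat.ListAction using (sum)
open import Data.Nat.Properties
  using ( ≤-refl; ≤-reflexive; ≤-trans; <⇒≤; <⇒≱; ≮⇒≥; ≰⇒>; ≤-<-trans; _<?_; n≤1+n; n<1+n; m≤n⇒m≤1+n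
        ; +-suc; +-identityʳ; +-assoc; +-monoʳ-≤; +-monoˡ-≤; +-mono-≤; +-commutativeSemigroup
        ; *-comm; *-distribˡ-+; *-monoʳ-≤; *-monoˡ-≤; ^-*-assoc; ^-monoˡ-≤; ^-monoʳ-≤; ^-monoʳ-<
        ; module ≤-Reasoning)
open import Data.Nat.Tactic.RingSolver using (solve-∀)
open import Data.Product.Base using (Σ; ∃; _×_; _,_; proj₁; proj₂; uncurry)
open import Data.Rational.Base as ℚ using (ℚ; 0ℚ; 1ℚ; ↥_; ↧ₙ_; toℚᵘ)
import Data.Rational.Properties as ℚ
open import Data.Rational.Unnormalised.Base as ℚᵘ using (mkℚᵘ; *≡*; *<*; *≤*)
import Data.Rational.Unnormalised.Properties as ℚᵘ
open import Data.Sum.Base using (_⊎_; inj₁; inj₂)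
open import Data.Vec.Base using (Vec; []; _∷_; lookup; tabulate; tail; updateAt)
open import Data.Vec.Properties
  using (≡-dec; lookup∘tabulate; tabulate∘lookup; tabulate-cong; updateAt-updateAt; updateAt-id-local)
open import Algebra.Definitions.RawSemiring ℚ.+-*-rawSemiring using () renaming (_^_ to _^ℚ_)
open import Algebra.Properties.CommutativeSemigroup +-commutativeSemigroup using (x∙yz≈y∙xz)
open import Function.Base using (_∘_)
open import Function.Bundles using (Inverse; Equivalence)
open import Induction.WellFounded using (Acc; acc)
open import Level using (0ℓ)
open import Relation.Binary.Definitions using (Tri; tri<; tri≈; tri>)
open import Relation.Binary.PropositionalEquality
  using (_≡_; _≢_; refl; sym; trans; cong; cong₂; subst; subst₂; module ≡-Reasoning)
import Relation.Binary.Reasoning.Setoid as ≃-Reasoning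
open import Relation.Nullary.Decidable
  using (Dec; yes; no; does; ⌊_⌋; toWitness; fromWitness; dec-true; dec-false; ¬?; _×-dec_)
open import Relation.Nullary.Negation using (¬_; contradiction)
open import Relation.Unary using (Pred; Decidable; _⊆_; _∪_)

private
  variable
    n ℓ L : ℕ

-- Parities of weights over a subset of the hypercube

-- The sum in the field with two elements of g over the members of a subset.
parity : (Fin n → Bool) → Subset n → Bool
parity g []      = false
parity g (b ∷ u) = (b ∧ g zero) xor parity (g ∘ suc) u

-- The neighbour of u in direction x.
flip : Subset n → Fin n → Subset n
flip u x = updateAt u x not

xor-left-comm : ∀ a b c → a xor (b xor c) ≡ b xor (a xor c)
xor-left-comm false b     c = refl
xor-left-comm true  false c = refl
xor-left-comm true  true  c = refl

xor-not : ∀ a b → a xor not b ≡ not (a xor b)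
xor-not a b = sym (not-distribʳ-xor a b)

xor-cancelʳ : ∀ a b → a xor b ≡ b → a ≡ false
xor-cancelʳ false b     _  = refl
xor-cancelʳ true  false ()
xor-cancelʳ true  true  ()

parity-flip : ∀ (g : Fin n → Bool) u x → parity g (flip u x) ≡ g x xor parity g u
parity-flip g (b ∷ u) (suc x) = trans
  (cong ((b ∧ g zero) xor_) (parity-flip (g ∘ suc) u x))
  (xor-left-comm (b ∧ g zero) (g (suc x)) _)
parity-flip g (true ∷ u) zero with g zero
... | true  = sym (not-involutive _)
... | false = refl
parity-flip g (false ∷ u) zero = refl

flip-flip : ∀ (u : Subset n) x → flip (flip u x) x ≡ u
flip-flip u x = trans (updateAt-updateAt x u)
  (updateAt-id-local x u (not-involutive _))

-- Weights on pairs of directions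

-- Indicators of x = y, of x ≠ y and of y < x.
equal differ below : Fin n → Fin n → Bool
equal  x y = does (x Fin.≟ y)
differ x y = not (equal x y)
below  x y = does (y Fin.<? x)

equal-refl : ∀ (x : Fin n) → equal x x ≡ true
equal-refl x = dec-true (x Fin.≟ x) refl

equal-≢ : ∀ {x y : Fin n} → x ≢ y → equal x y ≡ false
equal-≢ {x = x} {y} = dec-false (x Fin.≟ y)

differ-refl : ∀ (x : Fin n) → differ x x ≡ false
differ-refl x = cong not (equal-refl x)

differ-≢ : ∀ {x y : Fin n} → x ≢ y → differ x y ≡ true
differ-≢ x≢y = cong not (equal-≢ x≢y)

below-refl : ∀ (x : Fin n) → below x x ≡ false
below-refl x = dec-false (x Fin.<? x) (Fin.<-irrefl refl)

below-antisym : ∀ {x y : Fin n} → x ≢ y → below x y ≡ not (below y x)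
below-antisym {x = x} {y} x≢y with Fin.<-cmp x y
... | tri< x<y _ y≮x = trans (dec-false (y Fin.<? x) y≮x) (sym (cong not (dec-true (x Fin.<? y) x<y)))
... | tri≈ _ x≡y _   = ⊥-elim (x≢y x≡y)
... | tri> x≮y _ y<x = trans (dec-true (y Fin.<? x) y<x) (sym (cong not (dec-false (x Fin.<? y) x≮y)))

-- If x and y lie on the same side of z, then z lies on the same side of both.
below-swap : ∀ {x y z : Fin n} → x ≢ z → y ≢ z → below z x ≡ below z y → below x z ≡ below y z
below-swap x≢z y≢z eq = trans (below-antisym x≢z) (trans (cong not eq) (sym (below-antisym y≢z)))

-- If z does not lie strictly between x < y, then y exceeds z exactly when x
-- does or z is x; so y exceeds one element more than x does.
below-adjacent : ∀ {x y z : Fin n} → x Fin.< y → (x Fin.< z → z Fin.< y → ⊥) →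
                 below y z ≡ equal x z xor below x z
below-adjacent {x = x} {y} {z} x<y none with Fin.<-cmp x z
... | tri< x<z x≢z z≮x rewrite dec-false (x Fin.≟ z) x≢z | dec-false (z Fin.<? x) z≮x
    = dec-false (z Fin.<? y) (none x<z)
... | tri≈ _ refl _ rewrite dec-true (x Fin.≟ x) refl | dec-false (x Fin.<? x) (Fin.<-irrefl refl)
    = dec-true (x Fin.<? y) x<y
... | tri> _ x≢z z<x rewrite dec-false (x Fin.≟ z) x≢z | dec-true (z Fin.<? x) z<x
    = dec-true (z Fin.<? y) (Fin.<-trans z<x x<y)

lookup-ext : ∀ {u v : Subset ℓ} → (∀ j → lookup u j ≡ lookup v j) → u ≡ v
lookup-ext {u = u} {v} eq = trans (sym (tabulate∘lookup u)) (trans (tabulate-cong eq) (tabulate∘lookup v))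

-- The j-th bit of a label, made to vanish on the diagonal.
labelBit : (Fin n → Fin n → Subset ℓ) → Fin ℓ → Fin n → Fin n → Bool
labelBit label j x y = differ x y ∧ lookup (label x y) j

labelBit-refl : ∀ (label : Fin n → Fin n → Subset ℓ) j x → labelBit label j x x ≡ false
labelBit-refl label j x rewrite differ-refl x = refl

-- On the cycle a, b, c, e, f each element would be greater than both of its
-- neighbours or smaller than both; but a cycle of odd length cannot alternate.
no-alternating-cycle : ∀ {a b c e f : Fin n} →
  a ≢ b → b ≢ c → c ≢ e → e ≢ f → f ≢ a →
  below a f ≡ below a b → below b a ≡ below b c → below c b ≡ below c e →
  below e c ≡ below e f → below f e ≡ below f a → ⊥
no-alternating-cycle {a = a} {b} {c} {e} {f} a≢b b≢c c≢e e≢f f≢a p q r s t = absurd _ (begin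
  below a b             ≡⟨ below-antisym a≢b ⟩
  not (below b a)       ≡⟨ cong not q ⟩
  not (below b c)       ≡⟨ cong not (below-antisym b≢c) ⟩
  not (not (below c b)) ≡⟨ not-involutive _ ⟩
  below c b             ≡⟨ r ⟩
  below c e             ≡⟨ below-antisym c≢e ⟩
  not (below e c)       ≡⟨ cong not s ⟩
  not (below e f)       ≡⟨ cong not (below-antisym e≢f) ⟩
  not (not (below f e)) ≡⟨ not-involutive _ ⟩
  below f e             ≡⟨ t ⟩
  below f a             ≡⟨ below-antisym f≢a ⟩
  not (below a f)       ≡⟨ cong not p ⟩
  not (below a b)       ∎)
  where
    open ≡-Reasoning
    absurd : ∀ x → x ≡ not x → ⊥
    absurd true  ()
    absurd false ()

-- Neither p, q nor r separates x from y, so the ranks of x and y among the five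
-- elements differ by one and are not both even.
no-even-neighbours : ∀ {x y p q r : Fin n} →
  x ≢ y → x ≢ p → y ≢ p → x ≢ q → y ≢ q → x ≢ r → y ≢ r →
  below p x ≡ below p y → below q x ≡ below q y → below r x ≡ below r y →
  below x r xor (below x q xor (below x p xor below x y)) ≡ false →
  below y x xor (below y r xor (below y q xor below y p)) ≡ false → ⊥
no-even-neighbours {x = x} {y} {p} {q} {r} x≢y x≢p y≢p x≢q y≢q x≢r y≢r ep eq er ex ey
  rewrite below-swap x≢p y≢p ep | below-swap x≢q y≢q eq | below-swap x≢r y≢r er
        | below-antisym x≢y
  = absurd (trans (sym ex) (trans (rotate (below y x) (below y p) (below y q) (below y r)) (cong not ey)))
  where
    absurd : false ≢ true
    absurd ()

    rotate : ∀ a b c e → e xor (c xor (b xor not a)) ≡ not (a xor (e xor (c xor b)))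
    rotate a b c e = begin
      e xor (c xor (b xor not a))   ≡⟨ cong (λ s → e xor (c xor s)) (xor-not b a) ⟩
      e xor (c xor not (b xor a))   ≡⟨ cong (e xor_) (xor-not c (b xor a)) ⟩
      e xor not (c xor (b xor a))   ≡⟨ xor-not e _ ⟩
      not (e xor (c xor (b xor a))) ≡⟨ cong not (sym (trans (xor-assoc e (c xor b) a) (cong (e xor_) (xor-assoc c b a)))) ⟩
      not ((e xor (c xor b)) xor a) ≡⟨ cong not (xor-comm _ a) ⟩
      not (a xor (e xor (c xor b))) ∎
      where open ≡-Reasoning

-- Closed walks of length ten

-- A closed walk of length ten in the hypercube that never turns back at once,
-- unrolled to a sequence of period ten; d i is the direction of the edge from
-- V i to V (suc i).
record ClosedWalk (n : ℕ) : Set where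
  field
    V        : ℕ → Subset n
    d        : ℕ → Fin n
    step     : ∀ i → V (suc i) ≡ flip (V i) (d i)
    V-closed : ∀ i → V (10 + i) ≡ V i
    d-closed : ∀ i → d (10 + i) ≡ d i
    proper   : ∀ i → V (2 + i) ≢ V i

-- The sum of g over k consecutive directions, from the i-th on.
sumFrom : (ℕ → Fin n) → (Fin n → Bool) → ℕ → ℕ → Bool
sumFrom d g zero    i = false
sumFrom d g (suc k) i = g (d (k + i)) xor sumFrom d g k i

module _ (W : ClosedWalk n) where
  open ClosedWalk W

  -- All edges of the walk get the same colour from the weight h.
  Constant : (Fin n → Fin n → Bool) → Set
  Constant h = ∃ λ c → ∀ i → parity (h (d i)) (V i) ≡ c

  parity-advance : ∀ g k i → parity g (V (k + i)) ≡ sumFrom d g k i xor parity g (V i)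
  parity-advance g zero    i = refl
  parity-advance g (suc k) i = begin
    parity g (V (suc k + i))                                 ≡⟨ cong (parity g) (step (k + i)) ⟩
    parity g (flip (V (k + i)) (d (k + i)))                  ≡⟨ parity-flip g (V (k + i)) _ ⟩
    g (d (k + i)) xor parity g (V (k + i))                   ≡⟨ cong (g (d (k + i)) xor_) (parity-advance g k i) ⟩
    g (d (k + i)) xor (sumFrom d g k i xor parity g (V i))   ≡⟨ sym (xor-assoc (g (d (k + i))) _ _) ⟩
    sumFrom d g (suc k) i xor parity g (V i)                 ∎
    where open ≡-Reasoning

  sum-period : ∀ g i → sumFrom d g 10 i ≡ false
  sum-period g i = xor-cancelʳ _ (parity g (V i))
    (trans (sym (parity-advance g 10 i)) (cong (parity g) (V-closed i)))

  -- Between two uses of a direction x, the weights h x sum to 0.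
  sum-return : ∀ h → Constant h → ∀ k i → d i ≡ d (k + i) → sumFrom d (h (d i)) k i ≡ false
  sum-return h (c , const) k i eq = xor-cancelʳ _ (parity (h (d i)) (V i)) (begin
    sumFrom d (h (d i)) k i xor parity (h (d i)) (V i) ≡⟨ sym (parity-advance (h (d i)) k i) ⟩
    parity (h (d i)) (V (k + i))                       ≡⟨ cong (λ x → parity (h x) (V (k + i))) eq ⟩
    parity (h (d (k + i))) (V (k + i))                 ≡⟨ const (k + i) ⟩
    c                                                  ≡⟨ sym (const i) ⟩
    parity (h (d i)) (V i)                             ∎)
    where open ≡-Reasoning

  module _ (h : Fin n → Fin n → Bool) (h-refl : ∀ x → h x x ≡ false) (const : Constant h) where

    sum-return₃ : ∀ i → d i ≡ d (3 + i) → h (d i) (d (1 + i)) ≡ h (d i) (d (2 + i))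
    sum-return₃ i eq with sum-return h const 3 i eq
    ... | e rewrite h-refl (d i) = lemma _ _ e
      where
        lemma : ∀ a b → a xor (b xor false) ≡ false → b ≡ a
        lemma false false _ = refl
        lemma true  true  _ = refl

    sum-return₅ : ∀ i → d i ≡ d (5 + i) →
      h (d i) (d (4 + i)) xor (h (d i) (d (3 + i)) xor (h (d i) (d (2 + i)) xor h (d i) (d (1 + i)))) ≡ false
    sum-return₅ i eq with sum-return h const 5 i eq
    ... | e rewrite h-refl (d i) with h (d i) (d (1 + i))
    ... | true  = e
    ... | false = e

  -- How far apart the two uses of a direction are

  module _ (differ-const : Constant differ) where

    ≢₁ : ∀ i → d i ≢ d (1 + i)
    ≢₁ i eq = proper i (begin
      V (2 + i)                         ≡⟨ step (1 + i) ⟩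
      flip (V (1 + i)) (d (1 + i))      ≡⟨ cong₂ flip (step i) (sym eq) ⟩
      flip (flip (V i) (d i)) (d i)     ≡⟨ flip-flip (V i) (d i) ⟩
      V i                               ∎)
      where open ≡-Reasoning

    -- Between two uses of a direction the number of steps in other directions
    -- is even.
    ≢₂ : ∀ i → d i ≢ d (2 + i)
    ≢₂ i eq with sum-return differ differ-const 2 i eq
    ... | e rewrite differ-refl (d i) | differ-≢ (≢₁ i) with () ← e

    ≢₄ : ∀ i → d i ≢ d (4 + i)
    ≢₄ i eq with sum-return differ differ-const 4 i eq
    ... | e rewrite differ-refl (d i) | differ-≢ (≢₁ i) | differ-≢ (≢₂ i)
              | differ-≢ {x = d i} {d (3 + i)} (λ p → ≢₁ (3 + i) (trans (sym p) eq))
        with () ← e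

    -- Each direction is used an even number of times in a period, so at least
    -- once more; the other distances are excluded above.
    partner : ∀ i → d i ≡ d (3 + i) ⊎ d i ≡ d (5 + i) ⊎ d i ≡ d (7 + i)
    partner i with d i Fin.≟ d (3 + i) | d i Fin.≟ d (5 + i) | d i Fin.≟ d (7 + i)
    ... | yes p | _     | _     = inj₁ p
    ... | no _  | yes p | _     = inj₂ (inj₁ p)
    ... | no _  | no _  | yes p = inj₂ (inj₂ p)
    ... | no p₃ | no p₅ | no p₇ with sum-period (equal (d i)) i
    ... | e rewrite equal-refl (d i) | equal-≢ (≢₁ i) | equal-≢ (≢₂ i) | equal-≢ p₃ | equal-≢ (≢₄ i)
                  | equal-≢ p₅ | equal-≢ p₇
                  | equal-≢ {x = d i} {d (6 + i)} (λ p → ≢₄ (6 + i) (trans (sym p) (sym (d-closed i))))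
                  | equal-≢ {x = d i} {d (8 + i)} (λ p → ≢₂ (8 + i) (trans (sym p) (sym (d-closed i))))
                  | equal-≢ {x = d i} {d (9 + i)} (λ p → ≢₁ (9 + i) (trans (sym p) (sym (d-closed i))))
        with () ← e

    -- Excluding the remaining pairings

    module _ (below-const : Constant below) (label : Fin n → Fin n → Subset ℓ)
             (label-const : ∀ j → Constant (labelBit label j))
             (label-sym : ∀ x y → label x y ≡ label y x)
             (no-triangle : ∀ {x y z} → x ≢ y → x ≢ z → y ≢ z →
                            label x y ≡ label x z → label x y ≡ label y z → ⊥) where

      below₃ : ∀ i → d i ≡ d (3 + i) → below (d i) (d (1 + i)) ≡ below (d i) (d (2 + i))
      below₃ = sum-return₃ below below-refl below-const

      below₅ : ∀ i → d i ≡ d (5 + i) →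
        below (d i) (d (4 + i)) xor (below (d i) (d (3 + i)) xor
          (below (d i) (d (2 + i)) xor below (d i) (d (1 + i)))) ≡ false
      below₅ = sum-return₅ below below-refl below-const

      label₃ : ∀ i → d i ≡ d (3 + i) → label (d i) (d (1 + i)) ≡ label (d i) (d (2 + i))
      label₃ i eq = lookup-ext λ j → unmask j
        (sum-return₃ (labelBit label j) (labelBit-refl label j) (label-const j) i eq)
        where
          unmask : ∀ j → labelBit label j (d i) (d (1 + i)) ≡ labelBit label j (d i) (d (2 + i)) →
                   lookup (label (d i) (d (1 + i))) j ≡ lookup (label (d i) (d (2 + i))) j
          unmask j e rewrite differ-≢ (≢₁ i) | differ-≢ (≢₂ i) = e

      -- The directions x, y, z, x, y in a row make x, y, z a monochromatic triangle.
      no-xyzxy : ∀ i → d i ≡ d (3 + i) → d (1 + i) ≡ d (4 + i) → ⊥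
      no-xyzxy i x≡ y≡ = no-triangle (≢₁ i) (≢₂ i) (≢₁ (1 + i)) (label₃ i x≡)
        (trans (label-sym _ _) (trans (cong (label (d (1 + i))) x≡) (sym (label₃ (1 + i) y≡))))

      -- If the direction x₀ recurs after three steps, then the partners of the
      -- next two steps leave two patterns; in every other case an exclusion of
      -- no-xyzxy, ≢₁, ≢₂ or ≢₄ applies.
      ≢₃ : ∀ i → d i ≢ d (3 + i)
      ≢₃ i p₀ with partner (1 + i) | partner (2 + i)
      ... | inj₁ p₁        | _              = no-xyzxy i p₀ p₁
      ... | inj₂ _         | inj₂ (inj₂ p₂) = no-xyzxy (9 + i)
            (trans (sym p₂) (sym (d-closed (2 + i))))
            (trans (d-closed i) (trans p₀ (sym (d-closed (3 + i)))))
      ... | inj₂ (inj₁ p₁) | inj₁ p₂ with partner (8 + i)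
      ...   | inj₁ p₈        = ≢₂ (6 + i) (trans (sym p₁) (sym (trans p₈ (d-closed (1 + i)))))
      ...   | inj₂ (inj₁ p₈) = ≢₂ (8 + i) (trans p₈ (trans (d-closed (3 + i)) (trans (sym p₀) (sym (d-closed i)))))
      ...   | inj₂ (inj₂ p₈) = ≢₄ (8 + i) (trans p₈ (trans (d-closed (5 + i)) (trans (sym p₂) (sym (d-closed (2 + i))))))
      ≢₃ i p₀ | inj₂ (inj₂ p₁) | inj₂ (inj₁ p₂) with partner (5 + i)
      ...   | inj₁ p₅        = ≢₄ (1 + i) (trans p₁ (sym p₅))
      ...   | inj₂ (inj₁ p₅) = ≢₂ (3 + i) (sym (trans p₅ (trans (d-closed i) p₀)))
      ...   | inj₂ (inj₂ p₅) = ≢₂ (5 + i) (trans p₅ (trans (d-closed (2 + i)) p₂))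
      -- The pattern x₀ x₁ x₂ x₀ x₄ x₅ x₁ x₂ x₅ x₄: x₁ and x₂ have even rank and
      -- none of the others separates them.
      ≢₃ i p₀ | inj₂ (inj₁ p₁) | inj₂ (inj₁ p₂) = two-threes (partner (4 + i)) (partner (5 + i))
        where
          two-threes : d (4 + i) ≡ d (7 + i) ⊎ d (4 + i) ≡ d (9 + i) ⊎ d (4 + i) ≡ d (11 + i) →
                      d (5 + i) ≡ d (8 + i) ⊎ d (5 + i) ≡ d (10 + i) ⊎ d (5 + i) ≡ d (12 + i) → ⊥
          two-threes (inj₁ p₄)        _ = ≢₂ (2 + i) (trans p₂ (sym p₄))
          two-threes (inj₂ (inj₂ p₄)) _ = ≢₂ (4 + i) (trans p₄ (trans (d-closed (1 + i)) p₁))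
          two-threes _ (inj₂ (inj₁ p₅)) = ≢₂ (3 + i) (sym (trans p₅ (trans (d-closed i) p₀)))
          two-threes _ (inj₂ (inj₂ p₅)) = ≢₂ (5 + i) (trans p₅ (trans (d-closed (2 + i)) p₂))
          two-threes (inj₂ (inj₁ p₄)) (inj₁ p₅) =
            no-even-neighbours {x = x₁} {x₂} {x₀} {x₄} {x₅} (≢₁ (1 + i))
              (λ p → ≢₁ i (sym p)) (λ p → ≢₂ i (sym p))
              (λ p → ≢₂ (4 + i) (trans (sym p) p₁)) (≢₂ (2 + i))
              (≢₄ (1 + i)) (λ p → ≢₂ (5 + i) (trans (sym p) p₂))
              (below₃ i p₀) four (subst₂ (λ y z → below x₅ y ≡ below x₅ z) (sym p₁) (sym p₂) (below₃ (5 + i) p₅))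
              (subst (λ z → below x₁ x₅ xor (below x₁ x₄ xor (below x₁ z xor below x₁ x₂)) ≡ false)
                (sym p₀) (below₅ (1 + i) p₁))
              (subst₂ (λ y z → below x₂ y xor (below x₂ x₅ xor (below x₂ x₄ xor below x₂ z)) ≡ false)
                (sym p₁) (sym p₀) (below₅ (2 + i) p₂))
            where
              x₀ x₁ x₂ x₄ x₅ : Fin n
              x₀ = d i
              x₁ = d (1 + i)
              x₂ = d (2 + i)
              x₄ = d (4 + i)
              x₅ = d (5 + i)
              four : below x₄ x₁ ≡ below x₄ x₂
              four with below₅ (4 + i) p₄
              ... | e rewrite sym p₅ | sym p₂ | sym p₁ = cancel (below x₄ x₅) _ _ e
                where
                  cancel : ∀ a b c → a xor (b xor (c xor a)) ≡ false → c ≡ b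
                  cancel false false false _ = refl
                  cancel false true  true  _ = refl
                  cancel true  false false _ = refl
                  cancel true  true  true  _ = refl
      -- The pattern x₀ x₁ x₂ x₀ x₄ x₂ x₆ x₄ x₁ x₆: the order alternates along the
      -- cycle x₀, x₂, x₄, x₆, x₁.
      ≢₃ i p₀ | inj₂ (inj₂ p₁) | inj₁ p₂ = all-three (partner (4 + i)) (partner (6 + i))
        where
          all-three : d (4 + i) ≡ d (7 + i) ⊎ d (4 + i) ≡ d (9 + i) ⊎ d (4 + i) ≡ d (11 + i) →
                      d (6 + i) ≡ d (9 + i) ⊎ d (6 + i) ≡ d (11 + i) ⊎ d (6 + i) ≡ d (13 + i) → ⊥
          all-three _ (inj₂ (inj₁ p₆)) = ≢₂ (6 + i) (trans p₆ (trans (d-closed (1 + i)) p₁))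
          all-three _ (inj₂ (inj₂ p₆)) =
            ≢₄ (6 + i) (trans p₆ (trans (d-closed (3 + i)) (trans (sym p₀) (sym (d-closed i)))))
          all-three (inj₂ (inj₁ p₄)) (inj₁ p₆) = ≢₂ (4 + i) (trans p₄ (sym p₆))
          all-three (inj₂ (inj₂ p₄)) _ = ≢₄ (4 + i) (trans p₄ (trans (d-closed (1 + i)) p₁))
          all-three (inj₁ p₄) (inj₁ p₆) =
            no-alternating-cycle {a = x₀} {x₂} {x₄} {x₆} {x₁} (≢₂ i) (≢₂ (2 + i)) (≢₂ (4 + i))
              (λ p → ≢₂ (6 + i) (trans p p₁)) (λ p → ≢₁ i (sym p))
              (below₃ i p₀)
              (subst (λ z → below x₂ z ≡ below x₂ x₄) (sym p₀) (below₃ (2 + i) p₂))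
              (subst (λ z → below x₄ z ≡ below x₄ x₆) (sym p₂) (below₃ (4 + i) p₄))
              (subst₂ (λ y z → below x₆ y ≡ below x₆ z) (sym p₄) (sym p₁) (below₃ (6 + i) p₆))
              one
            where
              x₀ x₁ x₂ x₄ x₆ : Fin n
              x₀ = d i
              x₁ = d (1 + i)
              x₂ = d (2 + i)
              x₄ = d (4 + i)
              x₆ = d (6 + i)
              one : below x₁ x₆ ≡ below x₁ x₀
              one with below₃ (8 + i) (trans (sym p₁) (sym (d-closed (1 + i))))
              ... | e rewrite sym p₁ | sym p₆ | d-closed i = e

      -- The sum over a full period of five does not depend on its start.
      sumFrom-shift : (∀ i → d i ≡ d (5 + i)) → ∀ g i → sumFrom d g 5 i ≡ sumFrom d g 5 0
      sumFrom-shift recur g zero    = refl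
      sumFrom-shift recur g (suc i) = trans (trans
        (cong (λ x → g x xor (g₄ xor (g₃ xor (g₂ xor (g₁ xor false))))) (sym (recur i)))
        (rotate (g (d i)) g₁ g₂ g₃ g₄))
        (sumFrom-shift recur g i)
        where
          g₁ g₂ g₃ g₄ : Bool
          g₁ = g (d (1 + i))
          g₂ = g (d (2 + i))
          g₃ = g (d (3 + i))
          g₄ = g (d (4 + i))
          rotate : ∀ a b c e f → a xor (f xor (e xor (c xor (b xor false)))) ≡
                                 f xor (e xor (c xor (b xor (a xor false))))
          rotate a b c e f = trans (xor-left-comm a f _) (cong (f xor_)
            (trans (xor-left-comm a e _) (cong (e xor_)
            (trans (xor-left-comm a c _) (cong (c xor_) (xor-left-comm a b false))))))

      -- If every direction recurs after five steps, the five directions are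
      -- distinct and all have even rank among them, so that between any two of
      -- them there is a third.  Applied to the lower pair again and again, this
      -- is an infinite descent.
      no-five-recurrence : (∀ i → d i ≡ d (5 + i)) → ⊥
      no-five-recurrence recur = start (Fin.<-cmp (d 0) (d 1))
        where
          even-rank : ∀ i j → sumFrom d (below (d j)) 5 i ≡ false
          even-rank i j = trans (sumFrom-shift recur (below (d j)) i)
            (trans (sym (sumFrom-shift recur (below (d j)) j)) (sum-return below below-const 5 j (recur j)))

          descend : ∀ j → Acc Fin._<_ (d j) → ∀ i → d i Fin.< d j → ⊥
          descend j (acc smaller) i i<j = absurd (even-rank i i) (even-rank i j)
            where
              above : ∀ k → below (d j) (d k) ≡ equal (d i) (d k) xor below (d i) (d k)
              above k = below-adjacent i<j (λ i<k k<j → descend k (smaller k<j) i i<k)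

              absurd : sumFrom d (below (d i)) 5 i ≡ false → sumFrom d (below (d j)) 5 i ≡ false → ⊥
              absurd ei ej
                rewrite above i | above (1 + i) | above (2 + i) | above (3 + i) | above (4 + i)
                      | equal-refl (d i) | equal-≢ (≢₁ i) | equal-≢ (≢₂ i) | equal-≢ (≢₃ i) | equal-≢ (≢₄ i)
                      | below-refl (d i)
                with b₁ ← below (d i) (d (1 + i)) | b₂ ← below (d i) (d (2 + i))
                   | b₃ ← below (d i) (d (3 + i)) | b₄ ← below (d i) (d (4 + i))
                rewrite xor-not b₁ false | xor-not b₂ (b₁ xor false) | xor-not b₃ (b₂ xor (b₁ xor false))
                      | xor-not b₄ (b₃ xor (b₂ xor (b₁ xor false))) | ei
                with () ← ej

          start : Tri (d 0 Fin.< d 1) (d 0 ≡ d 1) (d 1 Fin.< d 0) → ⊥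
          start (tri< lt _ _) = descend 1 (Fin.<-wellFounded (d 1)) 0 lt
          start (tri≈ _ eq _) = ≢₁ 0 eq
          start (tri> _ _ gt) = descend 0 (Fin.<-wellFounded (d 0)) 1 gt

      -- No closed walk has all its edges of one colour.
      no-constant-walk : ⊥
      no-constant-walk = no-five-recurrence recur
        where
          recur : ∀ i → d i ≡ d (5 + i)
          recur i with partner i
          ... | inj₁ p        = ⊥-elim (≢₃ i p)
          ... | inj₂ (inj₁ p) = p
          ... | inj₂ (inj₂ p) = ⊥-elim (≢₃ (7 + i) (trans (sym p) (sym (d-closed i))))

-- Colouring the edges of the hypercube

-- The first position in which two bit vectors differ, or their length if they
-- agree.
firstDiff : Vec Bool L → Vec Bool L → Fin (suc L)
firstDiff []      []      = zero
firstDiff (a ∷ u) (b ∷ v) = if a xor b then zero else suc (firstDiff u v)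

firstDiff-sym : ∀ (u v : Vec Bool L) → firstDiff u v ≡ firstDiff v u
firstDiff-sym []      []      = refl
firstDiff-sym (a ∷ u) (b ∷ v) rewrite xor-comm a b | firstDiff-sym u v = refl

-- Three bits cannot be pairwise different.
firstDiff-no-triangle : ∀ (u v w : Vec Bool L) → u ≢ v → u ≢ w → v ≢ w →
  firstDiff u v ≡ firstDiff u w → firstDiff u v ≡ firstDiff v w → ⊥
firstDiff-no-triangle [] [] [] u≢v _ _ _ _ = u≢v refl
firstDiff-no-triangle (false ∷ u) (false ∷ v) (false ∷ w) p q r e f = firstDiff-no-triangle u v w
  (p ∘ cong (false ∷_)) (q ∘ cong (false ∷_)) (r ∘ cong (false ∷_)) (Fin.suc-injective e) (Fin.suc-injective f)
firstDiff-no-triangle (true ∷ u) (true ∷ v) (true ∷ w) p q r e f = firstDiff-no-triangle u v w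
  (p ∘ cong (true ∷_)) (q ∘ cong (true ∷_)) (r ∘ cong (true ∷_)) (Fin.suc-injective e) (Fin.suc-injective f)
firstDiff-no-triangle (false ∷ u) (false ∷ v) (true ∷ w)  _ _ _ () _
firstDiff-no-triangle (false ∷ u) (true ∷ v)  (false ∷ w) _ _ _ () _
firstDiff-no-triangle (false ∷ u) (true ∷ v)  (true ∷ w)  _ _ _ _ ()
firstDiff-no-triangle (true ∷ u)  (false ∷ v) (false ∷ w) _ _ _ _ ()
firstDiff-no-triangle (true ∷ u)  (false ∷ v) (true ∷ w)  _ _ _ () _
firstDiff-no-triangle (true ∷ u)  (true ∷ v)  (false ∷ w) _ _ _ () _

-- Distinct bit vectors of length L for the elements of Fin n: binary expansions.
address : n ≤ 2 ^ L → Fin n → Subset L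
address {L = L} n≤ x = Inverse.from (subset↔Fin L) (inject≤ x n≤)

address-injective : ∀ (n≤ : n ≤ 2 ^ L) {x y} → address n≤ x ≡ address n≤ y → x ≡ y
address-injective {L = L} n≤ eq = Fin.inject≤-injective n≤ n≤ _ _
  (trans (sym (I.strictlyInverseˡ _)) (trans (cong I.to eq) (I.strictlyInverseˡ _)))
  where module I = Inverse (subset↔Fin L)

flip-adjacent : ∀ (u : Subset n) x → Graph.Adj (FiniteGraph.graph (Q n)) u (flip u x)
flip-adjacent (false ∷ u) zero = inj₁ (out⊆ ⊆-refl , refl)
flip-adjacent (true  ∷ u) zero = inj₂ (out⊆ ⊆-refl , refl)
flip-adjacent (b ∷ u) (suc x) with flip-adjacent u x
flip-adjacent (false ∷ u) (suc x) | inj₁ (sub , size) = inj₁ (s⊆s sub , size)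
flip-adjacent (true  ∷ u) (suc x) | inj₁ (sub , size) = inj₁ (s⊆s sub , cong suc size)
flip-adjacent (false ∷ u) (suc x) | inj₂ (sub , size) = inj₂ (s⊆s sub , size)
flip-adjacent (true  ∷ u) (suc x) | inj₂ (sub , size) = inj₂ (s⊆s sub , cong suc size)

flip-injective : ∀ (u : Subset n) {x y} → flip u x ≡ flip u y → x ≡ y
flip-injective (b ∷ u) {zero}  {zero}  _  = refl
flip-injective (b ∷ u) {suc x} {suc y} eq = cong suc (flip-injective u (cong tail eq))
flip-injective (true  ∷ u) {zero} {suc y} ()
flip-injective (false ∷ u) {zero} {suc y} ()
flip-injective (true  ∷ u) {suc x} {zero} ()
flip-injective (false ∷ u) {suc x} {zero} ()

-- The cyclic successor on the vertices of the cycle.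
next : Fin 10 → Fin 10
next i = lookup (1F ∷ 2F ∷ 3F ∷ 4F ∷ 5F ∷ 6F ∷ 7F ∷ 8F ∷ 9F ∷ 0F ∷ []) i

next-Next : ∀ i → Graph.Adj (FiniteGraph.graph (C 10)) i (next i)
next-Next = toWitness {a? = Fin.all? λ i → Graph.adj? (FiniteGraph.graph (C 10)) i (next i)} _

next-next-≢ : ∀ i → next (next i) ≢ i
next-next-≢ = toWitness {a? = Fin.all? λ i → ¬? (next (next i) Fin.≟ i)} _

-- The walk round the cycle that starts at vertex 0.
cycle : ℕ → Fin 10
cycle zero    = zero
cycle (suc i) = next (cycle i)

cycle-period : ∀ i → cycle (10 + i) ≡ cycle i
cycle-period i = returns (cycle i)
  where
    returns : ∀ a → next (next (next (next (next (next (next (next (next (next a))))))))) ≡ a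
    returns = toWitness {a? = Fin.all? λ a → _ Fin.≟ a} _

-- Directions are told apart by L bits, the suc L values of firstDiff by ℓ bits.
module Colouring {n L ℓ : ℕ} (n≤ : n ≤ 2 ^ L) (L< : suc L ≤ 2 ^ ℓ) where

  -- The binary code of the first place in which x and y differ.
  label : Fin n → Fin n → Subset ℓ
  label x y = address L< (firstDiff (address n≤ x) (address n≤ y))

  label-sym : ∀ x y → label x y ≡ label y x
  label-sym x y = cong (address L<) (firstDiff-sym (address n≤ x) (address n≤ y))

  label-no-triangle : ∀ {x y z} → x ≢ y → x ≢ z → y ≢ z →
                      label x y ≡ label x z → label x y ≡ label y z → ⊥
  label-no-triangle p q r e f = firstDiff-no-triangle _ _ _
    (p ∘ address-injective n≤) (q ∘ address-injective n≤) (r ∘ address-injective n≤)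
    (address-injective L< e) (address-injective L< f)

  -- The coordinates of the weight that defines the colouring.
  weight : Fin (2 + ℓ) → Fin n → Fin n → Bool
  weight zero          = differ
  weight (suc zero)    = below
  weight (suc (suc j)) = labelBit label j

  weight-refl : ∀ j x → weight j x x ≡ false
  weight-refl zero          = differ-refl
  weight-refl (suc zero)    = below-refl
  weight-refl (suc (suc j)) = labelBit-refl label j

  -- The colour of the edge at u in direction x.
  colour : Subset n → Fin n → Subset (2 + ℓ)
  colour u x = tabulate λ j → parity (weight j x) u

  colour-flip : ∀ u x → colour (flip u x) x ≡ colour u x
  colour-flip u x = tabulate-cong λ j →
    trans (parity-flip (weight j x) u x) (cong (_xor parity (weight j x) u) (weight-refl j x))

  -- u and v are the ends of an edge of colour c.
  Edge : Subset (2 + ℓ) → Subset n → Subset n → Set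
  Edge c u v = ∃ λ x → flip u x ≡ v × colour u x ≡ c

  edge? : ∀ c u v → Dec (Edge c u v)
  edge? c u v = Fin.any? λ x → ≡-dec Bool._≟_ (flip u x) v ×-dec ≡-dec Bool._≟_ (colour u x) c

  Edge-sym : ∀ {c u v} → Edge c u v → Edge c v u
  Edge-sym {u = u} (x , refl , refl) = x , flip-flip u x , colour-flip u x

  colourClass : Subset (2 + ℓ) → Subgraph (FiniteGraph.graph (Q n))
  colourClass c = record
    { vertex = λ _ → true
    ; adj    = λ u v → ⌊ edge? c u v ⌋
    ; sym    = λ {u} {v} t → fromWitness {a? = edge? c v u} (Edge-sym (toWitness {a? = edge? c u v} t))
    ; ends   = λ _ → _
    ; incl   = λ {u} {v} t → adjacent (toWitness {a? = edge? c u v} t)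
    }
    where
      adjacent : ∀ {u v} → Edge c u v → Graph.Adj (FiniteGraph.graph (Q n)) u v
      adjacent {u} (x , refl , _) = flip-adjacent u x

  -- A cycle of length ten in a colour class gives a closed walk on which every
  -- weight is constant.
  colourClass-free : ∀ c → Free (FiniteGraph.graph (C 10)) (colourClass c)
  colourClass-free c (S , iso) =
    no-constant-walk walk (constant zero) (constant (suc zero)) label (λ j → constant (suc (suc j)))
      label-sym label-no-triangle
    where
      module I = _≅_ iso
      module S = Subgraph S

      φ : Fin 10 → Subset n
      φ a = proj₁ (proj₁ (I.from a))

      irrelevant : {A : Set} {p : A → Bool} {x y : Σ A (T ∘ p)} → proj₁ x ≡ proj₁ y → x ≡ y
      irrelevant {x = _ , s} {_ , t} refl = cong (_ ,_) (T-irrelevant s t)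

      φ-injective : ∀ {a b} → φ a ≡ φ b → a ≡ b
      φ-injective {a} {b} eq = trans (sym (I.strictlyInverseˡ a))
        (trans (cong I.to (irrelevant {p = S.vertex} (irrelevant {p = λ _ → true} eq))) (I.strictlyInverseˡ b))

      φ-edge : ∀ a → Edge c (φ a) (φ (next a))
      φ-edge a = toWitness {a? = edge? c (φ a) (φ (next a))}
        (S.incl (Equivalence.from (I.preserves (I.from a) (I.from (next a)))
          (subst₂ (Graph.Adj (FiniteGraph.graph (C 10)))
            (sym (I.strictlyInverseˡ a)) (sym (I.strictlyInverseˡ (next a))) (next-Next a))))

      walk : ClosedWalk n
      walk = record
        { V        = λ i → φ (cycle i)
        ; d        = λ i → proj₁ (φ-edge (cycle i))
        ; step     = λ i → sym (proj₁ (proj₂ (φ-edge (cycle i))))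
        ; V-closed = λ i → cong φ (cycle-period i)
        ; d-closed = λ i → cong (proj₁ ∘ φ-edge) (cycle-period i)
        ; proper   = λ i eq → next-next-≢ (cycle i) (φ-injective eq)
        }

      constant : ∀ j → Constant walk (weight j)
      constant j = lookup c j , λ i → trans
        (sym (lookup∘tabulate (λ j → parity (weight j (ClosedWalk.d walk i)) (ClosedWalk.V walk i)) j))
        (cong (λ c → lookup c j) (proj₂ (proj₂ (φ-edge (cycle i)))))

-- Counting edges

module _ {A : Set} where

  -- The number of entries of a list that satisfy P.
  count : {P : Pred A 0ℓ} → Decidable P → List A → ℕ
  count P? xs = length (filter P? xs)

  count-∪ : {P Q R : Pred A 0ℓ} (P? : Decidable P) (Q? : Decidable Q) (R? : Decidable R) →
            P ⊆ Q ∪ R → ∀ xs → count P? xs ≤ count Q? xs + count R? xs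
  count-∪ P? Q? R? P⊆ []       = z≤n
  count-∪ P? Q? R? P⊆ (x ∷ xs) with ih ← count-∪ P? Q? R? P⊆ xs | P? x | Q? x | R? x
  ... | no _  | no _  | no _   = ih
  ... | no _  | yes _ | no _   = m≤n⇒m≤1+n ih
  ... | no _  | no _  | yes _  = ≤-trans ih (+-monoʳ-≤ _ (n≤1+n _))
  ... | no _  | yes _ | yes _  = m≤n⇒m≤1+n (≤-trans ih (+-monoʳ-≤ _ (n≤1+n _)))
  ... | yes _ | yes _ | no _   = s≤s ih
  ... | yes _ | yes _ | yes _  = s≤s (≤-trans ih (+-monoʳ-≤ _ (n≤1+n _)))
  ... | yes _ | no _  | yes _  = ≤-trans (s≤s ih) (≤-reflexive (sym (+-suc _ _)))
  ... | yes p | no ¬q | no ¬r with P⊆ p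
  ...   | inj₁ q = contradiction q ¬q
  ...   | inj₂ r = contradiction r ¬r

  count-Any : {I : Set} {P : I → Pred A 0ℓ} (P? : ∀ i → Decidable (P i)) {M : ℕ} (xs : List A) →
              (∀ i → count (P? i) xs ≤ M) →
              ∀ is → count (λ x → Any.any? (λ i → P? i x) is) xs ≤ length is * M
  count-Any P? xs bound []       =
    ≤-reflexive (cong length (filter-none (λ _ → no (λ ())) (All.universal (λ _ ()) xs)))
  count-Any P? xs bound (i ∷ is) = ≤-trans
    (count-∪ _ (P? i) (λ x → Any.any? (λ i → P? i x) is) (λ { (here p) → inj₁ p ; (there p) → inj₂ p }) xs)
    (+-mono-≤ (bound i) (count-Any P? xs bound is))

  count-injective : {P : Pred A 0ℓ} (P? : Decidable P) (xs : List A) {n : ℕ} (f : Fin n → A) →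
                    (∀ {i j} → f i ≡ f j → i ≡ j) → (∀ i → f i ∈ xs) → (∀ i → P (f i)) →
                    n ≤ count P? xs
  count-injective P? xs f f-inj f∈ Pf = Fin.injective⇒≤ {f = λ i → index (mem i)} λ {i} {j} eq →
    f-inj (trans (lookup-index (mem i)) (trans (cong (List.lookup (filter P? xs)) eq) (sym (lookup-index (mem j)))))
    where
      mem : ∀ i → f i ∈ filter P? xs
      mem i = ∈-filter⁺ P? (f∈ i) (Pf i)

count-map : {A B : Set} {P : Pred B 0ℓ} (P? : Decidable P) (f : A → B) →
            ∀ xs → count P? (map f xs) ≡ count (P? ∘ f) xs
count-map P? f []       = refl
count-map P? f (x ∷ xs) with does (P? (f x))
... | true  = cong suc (count-map P? f xs)
... | false = count-map P? f xs

module _ {A : Set} {E : A → A → Set} (E? : ∀ x y → Dec (E x y)) where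

  -- The number of E-related pairs (x , y) with x from xs and y from ys.
  degreeSum : List A → List A → ℕ
  degreeSum xs ys = sum (map (λ x → count (E? x) ys) xs)

  degreeSum-≥ : ∀ {δ} xs ys → (∀ x → δ ≤ count (E? x) ys) → length xs * δ ≤ degreeSum xs ys
  degreeSum-≥ []       ys deg = z≤n
  degreeSum-≥ (x ∷ xs) ys deg = +-mono-≤ (deg x) (degreeSum-≥ xs ys deg)

module _ {A : Set} {E : A → A → Set} (E? : ∀ x y → Dec (E x y))
         (E-sym : ∀ {x y} → E x y → E y x) (E-irrefl : ∀ {x} → ¬ E x x) where

  degreeSum-∷ : ∀ xs y ys → degreeSum E? xs (y ∷ ys) ≡ count (E? y) xs + degreeSum E? xs ys
  degreeSum-∷ []       y ys = refl
  degreeSum-∷ (x ∷ xs) y ys with E? x y | E? y x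
  ... | yes _   | yes _   = cong suc (trans (cong (λ s → count (E? x) ys + s) (degreeSum-∷ xs y ys)) (x∙yz≈y∙xz (count (E? x) ys) (count (E? y) xs) _))
  ... | no _    | no _    = trans (cong (λ s → count (E? x) ys + s) (degreeSum-∷ xs y ys)) (x∙yz≈y∙xz (count (E? x) ys) (count (E? y) xs) _)
  ... | yes exy | no ¬eyx = contradiction (E-sym exy) ¬eyx
  ... | no ¬exy | yes eyx = contradiction (E-sym eyx) ¬exy

  -- The degree sum is twice the number of edges.
  handshake : ∀ xs → degreeSum E? xs xs ≡ 2 * count (uncurry E?) (pairs xs)
  handshake []       = refl
  handshake (x ∷ xs) with E? x x
  ... | yes exx = contradiction exx E-irrefl
  ... | no _    = begin
    count (E? x) xs + degreeSum E? xs (x ∷ xs)           ≡⟨ cong (λ s → count (E? x) xs + s) (degreeSum-∷ xs x xs) ⟩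
    a + (a + degreeSum E? xs xs)                         ≡⟨ cong (λ s → a + (a + s)) (handshake xs) ⟩
    a + (a + 2 * b)                                      ≡⟨ double a b ⟩
    2 * (a + b)                                          ≡⟨ cong (2 *_) (sym split) ⟩
    2 * count (uncurry E?) (map (x ,_) xs ++ pairs xs)   ∎
    where
      open ≡-Reasoning
      a b : ℕ
      a = count (E? x) xs
      b = count (uncurry E?) (pairs xs)
      double : ∀ a b → a + (a + 2 * b) ≡ 2 * (a + b)
      double a b = trans (sym (+-assoc a a _)) (trans (cong (λ s → a + s + 2 * b) (sym (+-identityʳ a)))
        (sym (*-distribˡ-+ 2 a b)))
      split : count (uncurry E?) (map (x ,_) xs ++ pairs xs) ≡ a + b
      split = trans (cong length (filter-++ (uncurry E?) (map (x ,_) xs) (pairs xs)))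
        (trans (length-++ (filter (uncurry E?) (map (x ,_) xs)))
          (cong (_+ b) (count-map (uncurry E?) (x ,_) xs)))

vertices-∈ : (G : FiniteGraph) → ∀ v → v ∈ FiniteGraph.vertices G
vertices-∈ G v = subst (_∈ FiniteGraph.vertices G) (I.strictlyInverseʳ v) (∈-map⁺ I.from (∈-allFin (I.to v)))
  where module I = Inverse (FiniteGraph.enum G)

vertices-length : (G : FiniteGraph) → length (FiniteGraph.vertices G) ≡ FiniteGraph.order G
vertices-length G = trans (length-map _ (allFin (FiniteGraph.order G))) (length-tabulate {n = FiniteGraph.order G} (λ i → i))

module _ {n L ℓ : ℕ} (n≤ : n ≤ 2 ^ L) (L< : suc L ≤ 2 ^ ℓ) where
  open Colouring {n} {L} {ℓ} n≤ L<

  private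
    colours : List (Subset (2 + ℓ))
    colours = FiniteGraph.vertices (Q (2 + ℓ))

    -- The union of all colour classes, which is the whole hypercube.
    Coloured : Subset n → Subset n → Set
    Coloured u v = Any (λ c → T (Subgraph.adj (colourClass c) u v)) colours

    coloured? : ∀ u v → Dec (Coloured u v)
    coloured? u v = Any.any? (λ c → T? (Subgraph.adj (colourClass c) u v)) colours

    degree-≥ : ∀ u → n ≤ count (coloured? u) (FiniteGraph.vertices (Q n))
    degree-≥ u = count-injective (coloured? u) (FiniteGraph.vertices (Q n)) (flip u) (flip-injective u) (λ x → vertices-∈ (Q n) _)
      λ x → lose (vertices-∈ (Q (2 + ℓ)) (colour u x)) (fromWitness {a? = edge? _ u (flip u x)} (x , refl , refl))

  -- The 2 ^ (2 + ℓ) colour classes cover all edges of the hypercube.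
  ex-bound : n * 2 ^ n ≤ 2 * (2 ^ (2 + ℓ) * ex (Q n) (C 10))
  ex-bound = begin
    n * 2 ^ n                                      ≡⟨ *-comm n _ ⟩
    2 ^ n * n                                      ≡⟨ cong (_* n) (sym (vertices-length (Q n))) ⟩
    length vs * n                                  ≤⟨ degreeSum-≥ coloured? vs vs degree-≥ ⟩
    degreeSum coloured? vs vs                      ≡⟨ handshake coloured? coloured-sym coloured-irrefl vs ⟩
    2 * count (uncurry coloured?) (pairs vs)       ≤⟨ *-monoʳ-≤ 2 (count-Any (λ c → T? ∘ uncurry (Subgraph.adj (colourClass c))) (pairs vs)
                                                        (λ c → ex-upper (Q n) (C 10) (colourClass c) (colourClass-free c)) colours) ⟩
    2 * (length colours * ex (Q n) (C 10))         ≡⟨ cong (λ k → 2 * (k * ex (Q n) (C 10))) (vertices-length (Q (2 + ℓ))) ⟩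
    2 * (2 ^ (2 + ℓ) * ex (Q n) (C 10))            ∎
    where
      open ≤-Reasoning
      vs : List (Subset n)
      vs = FiniteGraph.vertices (Q n)
      coloured-sym : ∀ {u v} → Coloured u v → Coloured v u
      coloured-sym = Any.map λ {c} → Subgraph.sym (colourClass c)
      coloured-irrefl : ∀ {u} → ¬ Coloured u u
      coloured-irrefl t with Any.satisfied t
      ... | c , e = Graph.irrefl (FiniteGraph.graph (Q n)) refl (Subgraph.incl (colourClass c) e)

-- Logarithms and rational powers

-- k is the rounded-down binary logarithm of n.
log-bracket : ∀ n → 1 ≤ n → ∃ λ k → 2 ^ k ≤ n × n < 2 ^ suc k
log-bracket 1             _ = 0 , ≤-refl , ≤-refl
log-bracket (suc (suc n)) _ with log-bracket (suc n) (s≤s z≤n)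
... | k , ≤n , n< with suc (suc n) <? 2 ^ suc k
...   | yes 1+n< = k , m≤n⇒m≤1+n ≤n , 1+n<
...   | no ¬1+n< = suc k , ≮⇒≥ ¬1+n< , ≤-<-trans n< (^-monoʳ-< 2 ≤-refl (n<1+n (suc k)))

^-cancelʳ-< : ∀ {m o} → 2 ^ m < 2 ^ o → m < o
^-cancelʳ-< 2^m<2^o = ≰⇒> λ o≤m → <⇒≱ 2^m<2^o (^-monoʳ-≤ 2 o≤m)

-- Here the directions are told apart by suc k bits, so that first differences
-- take 2 + k values, and these by suc m bits, where 2 ^ m ≤ 2 + k ≤ 3 * k.
ex-bound-log : ∀ {n k} → 1 ≤ k → n < 2 ^ suc k → n * 2 ^ n ≤ k * (48 * ex (Q n) (C 10))
ex-bound-log {n} {k} 1≤k n< =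
  estimate (ex-bound {n} {suc k} {suc m} (<⇒≤ n<) (<⇒≤ (proj₂ (proj₂ bracket))))
  where
    open ≤-Reasoning
    bracket : ∃ λ m → 2 ^ m ≤ 2 + k × 2 + k < 2 ^ suc m
    bracket = log-bracket (2 + k) (s≤s z≤n)
    m : ℕ
    m = proj₁ bracket
    2^m≤3k : 2 ^ m ≤ 2 * k + k
    2^m≤3k = ≤-trans (proj₁ (proj₂ bracket)) (+-monoˡ-≤ k (*-monoʳ-≤ 2 1≤k))
    regroup : ∀ a e → 2 * (2 * (2 * (2 * a)) * e) ≡ 16 * (a * e)
    regroup = solve-∀
    triple : ∀ k e → 16 * ((2 * k + k) * e) ≡ k * (48 * e)
    triple = solve-∀
    estimate : ∀ {N e} → N ≤ 2 * (2 ^ (2 + suc m) * e) → N ≤ k * (48 * e)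
    estimate {N} {e} N≤ = begin
      N                          ≤⟨ N≤ ⟩
      2 * (2 ^ (2 + suc m) * e)  ≡⟨ regroup (2 ^ m) e ⟩
      16 * (2 ^ m * e)           ≤⟨ *-monoʳ-≤ 16 (*-monoˡ-≤ e 2^m≤3k) ⟩
      16 * ((2 * k + k) * e)     ≡⟨ triple k e ⟩
      k * (48 * e)               ∎

toℚᵘ-fromℕ : ∀ m → toℚᵘ (fromℕ m) ℚᵘ.≃ mkℚᵘ (+ m) 0
toℚᵘ-fromℕ m = ℚ.toℚᵘ-fromℚᵘ (mkℚᵘ (+ m) 0)

fromℕ-mono-≤ : ∀ {m o} → m ≤ o → fromℕ m ℚ.≤ fromℕ o
fromℕ-mono-≤ {m} {o} m≤o = ℚ.toℚᵘ-cancel-≤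
  (ℚᵘ.≤-respˡ-≃ (ℚᵘ.≃-sym (toℚᵘ-fromℕ m)) (ℚᵘ.≤-respʳ-≃ (ℚᵘ.≃-sym (toℚᵘ-fromℕ o))
    (*≤* (ℤ.*-monoʳ-≤-nonNeg (+ 1) (ℤ.+≤+ m≤o)))))

fromℕ-* : ∀ m o → fromℕ (m * o) ≡ fromℕ m ℚ.* fromℕ o
fromℕ-* m o = ℚ.toℚᵘ-injective (begin
  toℚᵘ (fromℕ (m * o))              ≈⟨ toℚᵘ-fromℕ (m * o) ⟩
  mkℚᵘ (+ (m * o)) 0                ≈⟨ *≡* (cong (ℤ._* + 1) (ℤ.pos-* m o)) ⟩
  mkℚᵘ (+ m) 0 ℚᵘ.* mkℚᵘ (+ o) 0    ≈⟨ ℚᵘ.*-cong (ℚᵘ.≃-sym (toℚᵘ-fromℕ m)) (ℚᵘ.≃-sym (toℚᵘ-fromℕ o)) ⟩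
  toℚᵘ (fromℕ m) ℚᵘ.* toℚᵘ (fromℕ o) ≈⟨ ℚᵘ.≃-sym (ℚ.toℚᵘ-homo-* (fromℕ m) (fromℕ o)) ⟩
  toℚᵘ (fromℕ m ℚ.* fromℕ o)        ∎)
  where open ≃-Reasoning ℚᵘ.≃-setoid

log₂-bound : ∀ {n k p} → 2 ^ k ≤ n → log₂ n p → fromℕ k ℚ.< p
log₂-bound {n} {k} {p@(ℚ.mkℚ (+ a) d-1 _)} 2^k≤n (0≤p , n^d<2^a) =
  ℚ.toℚᵘ-cancel-< (ℚᵘ.<-respˡ-≃ (ℚᵘ.≃-sym (toℚᵘ-fromℕ k)) (*<* (subst₂ ℤ._<_
    (ℤ.pos-* k (suc d-1)) (sym (ℤ.*-identityʳ (+ a))) (ℤ.+<+ kd<a))))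
  where
    kd<a : k * suc d-1 < a
    kd<a = ^-cancelʳ-< (≤-<-trans (≤-trans (≤-reflexive (sym (^-*-assoc 2 k (suc d-1))))
      (^-monoˡ-≤ (suc d-1) 2^k≤n)) n^d<2^a)
log₂-bound {p = ℚ.mkℚ (ℤ.-[1+ _ ]) _ _} _ (ℚ.*≤* () , _)

^ℚ-nonNeg : ∀ {a} → 0ℚ ℚ.≤ a → ∀ m → 0ℚ ℚ.≤ a ^ℚ m
^ℚ-nonNeg 0≤a zero    = ℚ.*≤* (ℤ.+≤+ z≤n)
^ℚ-nonNeg {a} 0≤a (suc m) = subst (ℚ._≤ a ^ℚ suc m) (ℚ.*-zeroʳ a)
  (ℚ.*-monoˡ-≤-nonNeg a {{ℚ.nonNegative 0≤a}} (^ℚ-nonNeg 0≤a m))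

^ℚ-monoˡ-≤ : ∀ {a b} → 0ℚ ℚ.≤ a → a ℚ.≤ b → ∀ m → a ^ℚ m ℚ.≤ b ^ℚ m
^ℚ-monoˡ-≤ 0≤a a≤b zero = ℚ.≤-refl
^ℚ-monoˡ-≤ {a} {b} 0≤a a≤b (suc m) = ℚ.≤-trans
  (ℚ.*-monoˡ-≤-nonNeg a {{ℚ.nonNegative 0≤a}} (^ℚ-monoˡ-≤ 0≤a a≤b m))
  (ℚ.*-monoʳ-≤-nonNeg (b ^ℚ m) {{ℚ.nonNegative (^ℚ-nonNeg (ℚ.≤-trans 0≤a a≤b) m)}} a≤b)

^ℚ-monoʳ-≤ : ∀ {a} → 1ℚ ℚ.≤ a → ∀ {m o} → m ≤ o → a ^ℚ m ℚ.≤ a ^ℚ o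
^ℚ-monoʳ-≤ 1≤a {o = zero} z≤n = ℚ.≤-refl
^ℚ-monoʳ-≤ {a} 1≤a {o = suc o} z≤n = ℚ.≤-trans (^ℚ-monoʳ-≤ 1≤a {o = o} z≤n)
  (subst (ℚ._≤ a ^ℚ suc o) (ℚ.*-identityˡ _)
    (ℚ.*-monoʳ-≤-nonNeg (a ^ℚ o) {{ℚ.nonNegative (^ℚ-nonNeg 0≤a o)}} 1≤a))
  where
    0≤a : 0ℚ ℚ.≤ a
    0≤a = ℚ.≤-trans (ℚ.*≤* (ℤ.+≤+ z≤n)) 1≤a
^ℚ-monoʳ-≤ {a} 1≤a (s≤s m≤o) =
  ℚ.*-monoˡ-≤-nonNeg a {{ℚ.nonNegative (ℚ.≤-trans (ℚ.*≤* (ℤ.+≤+ z≤n)) 1≤a)}} (^ℚ-monoʳ-≤ 1≤a m≤o)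

-- The exponent q = u / d exceeds log₂ 3, so u ≥ d, and then
-- p ^ d ≤ p ^ u < x ^ d yields p < x.
log₂-power-bound : ∀ {n k x} → 1 ≤ k → 2 ^ k ≤ n → (log₂ n ^ᴿ log₂ 3) x → fromℕ k ℚ.< x
log₂-power-bound {n} {k} {x} 1≤k 2^k≤n (0≤x , p , q , (n<p , 0≤p) , ((_ , 3<q) , _) , p^u<x^d) =
  ℚ.<-trans k<p p<x
  where
    k<p : fromℕ k ℚ.< p
    k<p = log₂-bound {n} {k} 2^k≤n n<p
    d≤u : ↧ₙ q ≤ ℤ.∣ ↥ q ∣
    d≤u = <⇒≤ (^-cancelʳ-< (≤-<-trans (^-monoˡ-≤ (↧ₙ q) (s≤s (s≤s z≤n))) 3<q))
    p<x : p ℚ.< x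
    p<x = ℚ.≰⇒> λ x≤p → ℚ.<-irrefl refl (ℚ.<-≤-trans p^u<x^d (ℚ.≤-trans (^ℚ-monoˡ-≤ 0≤x x≤p (↧ₙ q))
      (^ℚ-monoʳ-≤ (ℚ.≤-trans (fromℕ-mono-≤ {1} {k} 1≤k) (ℚ.<⇒≤ k<p)) d≤u)))

-- The constant 1 / 48 turns a bound y * x < k * (48 * e) with k < x into
-- a bound on y by e.
divide-48 : ∀ {m k e x y} → m ≤ k * (48 * e) → 0ℚ ℚ.≤ x → fromℕ k ℚ.< x → y ℚ.* x ℚ.< fromℕ m →
            (+ 1 ℚ./ 48) ℚ.* y ℚ.≤ fromℕ e
divide-48 {m} {k} {e} {x} {y} m≤ 0≤x k<x yx<m = begin
  c ℚ.* y                          ≤⟨ ℚ.*-monoˡ-≤-nonNeg c (ℚ.<⇒≤ y<48e) ⟩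
  c ℚ.* fromℕ (48 * e)             ≡⟨ cong (c ℚ.*_) (fromℕ-* 48 e) ⟩
  c ℚ.* (fromℕ 48 ℚ.* fromℕ e)     ≡⟨ sym (ℚ.*-assoc c (fromℕ 48) (fromℕ e)) ⟩
  1ℚ ℚ.* fromℕ e                   ≡⟨ ℚ.*-identityˡ (fromℕ e) ⟩
  fromℕ e                          ∎
  where
    open ℚ.≤-Reasoning
    c : ℚ
    c = + 1 ℚ./ 48
    y<48e : y ℚ.< fromℕ (48 * e)
    y<48e = ℚ.*-cancelʳ-<-nonNeg x {{ℚ.nonNegative 0≤x}} (begin-strict
      y ℚ.* x                     <⟨ yx<m ⟩
      fromℕ m                     ≤⟨ fromℕ-mono-≤ {m} {k * (48 * e)} m≤ ⟩
      fromℕ (k * (48 * e))        ≡⟨ fromℕ-* k (48 * e) ⟩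
      fromℕ k ℚ.* fromℕ (48 * e)  ≤⟨ ℚ.*-monoʳ-≤-nonNeg (fromℕ (48 * e)) {{ℚ.nonNegative (fromℕ-mono-≤ {0} {48 * e} z≤n)}} (ℚ.<⇒≤ k<x) ⟩
      x ℚ.* fromℕ (48 * e)        ≡⟨ ℚ.*-comm x _ ⟩
      fromℕ (48 * e) ℚ.* x        ∎)

theorem4 : (λ n → ex (Q n) (C 10)) IsΩ (λ n → (n * 2 ^ n) /ᴿ (log₂ n ^ᴿ log₂ 3))
theorem4 = + 1 ℚ./ 48 , ℚ.*<* (ℤ.+<+ (s≤s z≤n)) , 2 , λ n 2≤n y (x , r<x , yx<m) →
  let k , 2^k≤n , n<2^1+k = log-bracket n (≤-trans (s≤s z≤n) 2≤n)
      1≤k = s≤s⁻¹ (^-cancelʳ-< {1} {suc k} (≤-<-trans 2≤n n<2^1+k))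
  in divide-48 {n * 2 ^ n} {k} {ex (Q n) (C 10)} {x} {y} (ex-bound-log {n} {k} 1≤k n<2^1+k)
       (proj₁ r<x) (log₂-power-bound {n} {k} {x} 1≤k 2^k≤n r<x) yx<m
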